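{- For any fixed integer $k>1$, the sequence $\{\mathrm{BoNa}(n,k)\}_{n\geq k+1}$ is log-concave.
   Context: A binary plane tree is a rooted plane tree on unlabeled vertices in which every non-leaf vertex has one or two children, and every child is a left child or a right child, even if it is the only child of its parent. A 0-1-tree is a binary plane tree in which every vertex that has two children is labeled 0 or 1 (no other vertex is labeled). A right edge is an edge connecting a vertex to its right child. For $n\ge 1$, the Boolean-Narayana number $\mathrm{BoNa}(n,k)$ is the number of 0-1-trees on $n$ vertices that have exactly $k-1$ right edges. A sequence $a_1,a_2,\ldots$ (finite or infinite) of nonnegative real numbers is log-concave if $a_{i-1}a_{i+1}\leq a_i^2$ for every index $i$ for which $a_{i-1}$, $a_i$ and $a_{i+1}$ are all terms of the sequence. -}

module Defs where

open import Data.Fin using (Fin; zero; suc; toℕ)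
open import Data.List using (List; []; _∷_; _++_; map; filter; length; lookup; cartesianProductWith)
open import Data.List.Membership.Propositional using (_∈_)
open import Data.List.Membership.Propositional.Properties
  using (∈-map⁺; ∈-map⁻; ∈-++⁺ˡ; ∈-++⁺ʳ; ∈-++⁻; ∈-cartesianProductWith⁺; ∈-cartesianProductWith⁻;
         ∈-filter⁺; ∈-filter⁻; ∈-lookup)
open import Data.List.Membership.Setoid.Properties using (unique⇒irrelevant)
open import Data.List.Relation.Binary.Disjoint.Propositional using (Disjoint)
open import Data.List.Relation.Unary.All using ([])
open import Data.List.Relation.Unary.AllPairs using ([]; _∷_)
open import Data.List.Relation.Unary.Any using (here; there; index)
open import Data.List.Relation.Unary.Any.Properties using (lookup-index)
open import Data.List.Relation.Unary.Unique.Propositional using (Unique)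
import Data.List.Relation.Unary.Unique.Propositional.Properties as Unique
open import Data.Nat using (ℕ; zero; suc; _+_; _∸_; _*_; _^_; _≤_; _<_; s≤s; _≟_)
open import Data.Nat.Properties using (≤-trans; ≤-reflexive; m≤m+n; m≤n+m; n<1+n; <-trans; <⇒≢)
import Data.Nat.Properties as ℕ
open import Data.Product using (∃; _×_; _,_; proj₁; proj₂)
open import Data.Sum using (inj₁; inj₂)
open import Function.Bundles using (_↔_; mk↔ₛ′)
open import Relation.Binary.PropositionalEquality using (_≡_; refl; sym; trans; cong; cong₂; setoid)
open import Relation.Nullary using (Dec)
open import Relation.Nullary.Decidable using (_×-dec_)

data 01Tree : Set where
  leaf      : 01Tree
  onlyLeft  : (l : 01Tree) → 01Tree
  onlyRight : (r : 01Tree) → 01Tree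
  both      : (label : Fin 2) (l r : 01Tree) → 01Tree

vertices : 01Tree → ℕ
vertices leaf          = 1
vertices (onlyLeft l)  = suc (vertices l)
vertices (onlyRight r) = suc (vertices r)
vertices (both _ l r)  = suc (vertices l + vertices r)

rightEdges : 01Tree → ℕ
rightEdges leaf          = 0
rightEdges (onlyLeft l)  = rightEdges l
rightEdges (onlyRight r) = suc (rightEdges r)
rightEdges (both _ l r)  = suc (rightEdges l + rightEdges r)

HasShape : ℕ → ℕ → 01Tree → Set
HasShape n j t = vertices t ≡ n × rightEdges t ≡ j

hasShape? : ∀ n j t → Dec (HasShape n j t)
hasShape? n j t = (vertices t ≟ n) ×-dec (rightEdges t ≟ j)

-- All trees whose root-to-leaf paths have at most h vertices, each listed
-- once; a tree with at most h vertices is among them.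
treesUpToHeight : ℕ → List 01Tree
treesUpToHeight zero    = []
treesUpToHeight (suc h) =
  leaf ∷ (map onlyLeft ts ++ (map onlyRight ts ++
    (cartesianProductWith (both zero) ts ts ++ cartesianProductWith (both (suc zero)) ts ts)))
  where ts = treesUpToHeight h

treesOfShape : ℕ → ℕ → List 01Tree
treesOfShape n j = filter (hasShape? n j) (treesUpToHeight n)

-- Meaningful for n, k ≥ 1; BoNa-cardinality below shows that this is the number
-- of 0-1-trees with n vertices and k - 1 right edges.
BoNa : ℕ → ℕ → ℕ
BoNa n k = length (treesOfShape n (k ∸ 1))

-- Log-concavity of the sequence a m , a (m + 1) , … : the terms a (i - 1),
-- a i, a (i + 1) all belong to it exactly when m < i.
LogConcaveFrom : ℕ → (ℕ → ℕ) → Set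
LogConcaveFrom m a = ∀ i → m < i → a (i ∸ 1) * a (i + 1) ≤ a i ^ 2

treesUpToHeight-complete : ∀ h t → vertices t ≤ h → t ∈ treesUpToHeight h
treesUpToHeight-complete (suc h) leaf          _         = here refl
treesUpToHeight-complete (suc h) (onlyLeft l)  (s≤s l≤h) =
  there (∈-++⁺ˡ (∈-map⁺ onlyLeft (treesUpToHeight-complete h l l≤h)))
treesUpToHeight-complete (suc h) (onlyRight r) (s≤s r≤h) =
  there (∈-++⁺ʳ (map onlyLeft ts)
    (∈-++⁺ˡ (∈-map⁺ onlyRight (treesUpToHeight-complete h r r≤h))))
  where ts = treesUpToHeight h
treesUpToHeight-complete (suc h) (both b l r)  (s≤s l+r≤h) =
  there (∈-++⁺ʳ (map onlyLeft ts) (∈-++⁺ʳ (map onlyRight ts) (labelled b)))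
  where
  ts = treesUpToHeight h
  l∈ = treesUpToHeight-complete h l (≤-trans (m≤m+n (vertices l) (vertices r)) l+r≤h)
  r∈ = treesUpToHeight-complete h r (≤-trans (m≤n+m (vertices r) (vertices l)) l+r≤h)
  labelled : ∀ b → both b l r ∈ cartesianProductWith (both zero) ts ts
                             ++ cartesianProductWith (both (suc zero)) ts ts
  labelled zero       = ∈-++⁺ˡ (∈-cartesianProductWith⁺ (both zero) l∈ r∈)
  labelled (suc zero) = ∈-++⁺ʳ (cartesianProductWith (both zero) ts ts)
                          (∈-cartesianProductWith⁺ (both (suc zero)) l∈ r∈)

private
  rootKind : 01Tree → ℕ
  rootKind leaf                  = 0
  rootKind (onlyLeft _)          = 1
  rootKind (onlyRight _)         = 2
  rootKind (both zero _ _)       = 3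
  rootKind (both (suc zero) _ _) = 4

  map-kind : ∀ {c} (f : 01Tree → 01Tree) → (∀ t → rootKind (f t) ≡ c) →
             ∀ {xs t} → t ∈ map f xs → rootKind t ≡ c
  map-kind f kind t∈ with ∈-map⁻ f t∈
  ... | s , _ , refl = kind s

  both-kind : ∀ b xs {t} → t ∈ cartesianProductWith (both b) xs xs → rootKind t ≡ 3 + toℕ b
  both-kind b xs t∈ with ∈-cartesianProductWith⁻ (both b) xs xs t∈
  both-kind zero       xs t∈ | _ , _ , _ , _ , refl = refl
  both-kind (suc zero) xs t∈ | _ , _ , _ , _ , refl = refl

  disjoint : ∀ {c xs ys} → (∀ {t} → t ∈ xs → rootKind t ≡ c) →
             (∀ {t} → t ∈ ys → c < rootKind t) → Disjoint xs ys
  disjoint xs-kind ys-kind (t∈xs , t∈ys) = <⇒≢ (ys-kind t∈ys) (sym (xs-kind t∈xs))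

  ++-kind : ∀ {c d xs ys} → c < d → (∀ {t} → t ∈ xs → rootKind t ≡ d) →
            (∀ {t} → t ∈ ys → d < rootKind t) → ∀ {t} → t ∈ xs ++ ys → c < rootKind t
  ++-kind {xs = xs} c<d xs-kind ys-kind t∈ with ∈-++⁻ xs t∈
  ... | inj₁ t∈xs = ≤-trans c<d (≤-reflexive (sym (xs-kind t∈xs)))
  ... | inj₂ t∈ys = <-trans c<d (ys-kind t∈ys)

treesUpToHeight-unique : ∀ h → Unique (treesUpToHeight h)
treesUpToHeight-unique zero    = []
treesUpToHeight-unique (suc h) =
  Unique.++⁺ ([] ∷ [])
    (Unique.++⁺ (Unique.map⁺ (λ { refl → refl }) u)
      (Unique.++⁺ (Unique.map⁺ (λ { refl → refl }) u)
        (Unique.++⁺ (bothUnique zero) (bothUnique (suc zero))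
          (disjoint (both-kind zero ts) from4))
        (disjoint onlyRight-kind from3))
      (disjoint onlyLeft-kind from2))
    (disjoint (λ { (here refl) → refl }) (++-kind (n<1+n 0) onlyLeft-kind from2))
  where
  ts = treesUpToHeight h
  u  = treesUpToHeight-unique h
  bothUnique : ∀ b → Unique (cartesianProductWith (both b) ts ts)
  bothUnique b = Unique.cartesianProductWith⁺ (both b) (λ { refl → refl , refl }) u u
  onlyLeft-kind : ∀ {t} → t ∈ map onlyLeft ts → rootKind t ≡ 1
  onlyLeft-kind = map-kind onlyLeft (λ _ → refl)
  onlyRight-kind : ∀ {t} → t ∈ map onlyRight ts → rootKind t ≡ 2
  onlyRight-kind = map-kind onlyRight (λ _ → refl)
  from4 : ∀ {t} → t ∈ cartesianProductWith (both (suc zero)) ts ts → 3 < rootKind t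
  from4 t∈ = ≤-reflexive (sym (both-kind (suc zero) ts t∈))
  from3 = ++-kind (n<1+n 2) (both-kind zero ts) from4
  from2 = ++-kind (n<1+n 1) onlyRight-kind from3

private
  index-∈-lookup : ∀ {A : Set} (xs : List A) i → index (∈-lookup {xs = xs} i) ≡ i
  index-∈-lookup (_ ∷ _)  zero    = refl
  index-∈-lookup (_ ∷ xs) (suc i) = cong suc (index-∈-lookup xs i)

  HasShape-≡ : ∀ {n j} {x y : ∃ (HasShape n j)} → proj₁ x ≡ proj₁ y → x ≡ y
  HasShape-≡ {x = t , p , q} {y = _ , p′ , q′} refl =
    cong (t ,_) (cong₂ _,_ (ℕ.≡-irrelevant p p′) (ℕ.≡-irrelevant q q′))

BoNa-cardinality : ∀ n k → Fin (BoNa n k) ↔ ∃ (HasShape n (k ∸ 1))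
BoNa-cardinality n k = mk↔ₛ′ to from to∘from from∘to
  where
  j = k ∸ 1
  ts = treesOfShape n j
  u : Unique ts
  u = Unique.filter⁺ (hasShape? n j) (treesUpToHeight-unique n)
  member : ∀ {t} → HasShape n j t → t ∈ ts
  member {t} s@(v≡n , _) =
    ∈-filter⁺ (hasShape? n j) (treesUpToHeight-complete n t (≤-reflexive v≡n)) s
  to : Fin (BoNa n k) → ∃ (HasShape n j)
  to i = lookup ts i , proj₂ (∈-filter⁻ (hasShape? n j) {xs = treesUpToHeight n} (∈-lookup i))
  from : ∃ (HasShape n j) → Fin (BoNa n k)
  from (_ , s) = index (member s)
  to∘from : ∀ x → to (from x) ≡ x
  to∘from (_ , s) = HasShape-≡ (sym (lookup-index (member s)))
  from∘to : ∀ i → from (to i) ≡ i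
  from∘to i = trans
    (cong index
      (unique⇒irrelevant (setoid 01Tree) (λ { refl refl → refl }) u
        (member (proj₂ (to i))) (∈-lookup i)))
    (index-∈-lookup ts i)

{-# OPTIONS --safe #-}
-- Write j = k - 1, and let m = n - j be the number of vertices without a right
-- child.  The generating function of 0-1-trees satisfies
-- T = z (1 + T) + u z T (1 + 2 T), so Lagrange inversion gives
--   j BoNa(m + j, j + 1) = C(m + j - 1, j - 1) S_j(m),
-- where S_j(m) is the coefficient of y in (1 + y)^m (1 + 2/y)^j.  These satisfy
-- S_0(m) = m and S_{j+1}(m+1) - S_{j+1}(m) = S_j(m) + S_j(m+1).  Sums of
-- consecutive terms and partial sums preserve log-concavity, so S_j is
-- log-concave in m, as is the binomial coefficient, and hence their product.
module Submission where

open import Defs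
open import Data.Fin using (Fin; zero)
open import Data.Fin.Permutation using (↔⇒≡)
open import Data.Fin.Properties using (0↔⊥; +↔⊎; *↔×)
open import Data.Empty using (⊥)
open import Data.Nat using (ℕ; zero; suc; _+_; _*_; _∸_; _^_; _≤_; _<_; z≤n; s≤s; z<s; s<s; >-nonZero)
open import Data.Nat.Combinatorics using (_C_; nC1≡n; k>n⇒nCk≡0; nCk+nC[k+1]≡[n+1]C[k+1]; nCk≡nC[n∸k])
open import Data.Nat.Properties
open import Data.Nat.Tactic.RingSolver using (solve-∀)
open import Data.Product using (∃; _×_; _,_; proj₁)
open import Data.Product.Function.NonDependent.Propositional using (_×-↔_)
open import Data.Sum using (_⊎_; inj₁; inj₂)
open import Data.Sum.Function.Propositional using (_⊎-↔_)
open import Data.Vec using (Vec; []; _∷_)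
open import Function using (_∘_)
open import Function.Bundles using (_↔_; mk↔ₛ′)
open import Function.Properties.Inverse using (↔-refl; ↔-sym; ↔-trans)
open import Relation.Binary.PropositionalEquality using (_≡_; refl; sym; trans; cong; cong₂; subst; subst₂; module ≡-Reasoning)

-- Closure properties of log-concave sequences.

LogConcave : (ℕ → ℕ) → Set
LogConcave a = ∀ m → a m * a (2 + m) ≤ a (1 + m) * a (1 + m)

-- Consecutive ratios of a log-concave sequence decrease; induction on `d` chains this, cancelling
-- `a (suc l)` in each step. Positivity is asked only from index 1 on, which admits `laurent j m 1`,
-- zero at `m = 0`.
logConcave-ratio : ∀ a → LogConcave a → (∀ m → 0 < a (suc m)) →
                   ∀ i d → a i * a (suc (d + i)) ≤ a (suc i) * a (d + i)
logConcave-ratio a lc pos i zero    = ≤-reflexive (*-comm (a i) (a (suc i)))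
logConcave-ratio a lc pos i (suc d) =
  *-cancelʳ-≤ _ _ (a (suc l)) {{>-nonZero (pos l)}} (begin
    (a i * a (2 + l)) * a (1 + l)          ≡⟨ swap (a i) (a (2 + l)) (a (1 + l)) ⟩
    (a i * a (1 + l)) * a (2 + l)          ≤⟨ *-monoˡ-≤ (a (2 + l)) (logConcave-ratio a lc pos i d) ⟩
    (a (1 + i) * a l) * a (2 + l)          ≡⟨ *-assoc (a (1 + i)) (a l) (a (2 + l)) ⟩
    a (1 + i) * (a l * a (2 + l))          ≤⟨ *-monoʳ-≤ (a (1 + i)) (lc l) ⟩
    a (1 + i) * (a (1 + l) * a (1 + l))    ≡⟨ *-assoc (a (1 + i)) (a (1 + l)) (a (1 + l)) ⟨
    (a (1 + i) * a (1 + l)) * a (1 + l)    ∎)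
  where
  open ≤-Reasoning
  l = d + i
  swap : ∀ x y z → (x * y) * z ≡ (x * z) * y
  swap = solve-∀

-- After the common product of `c m` and `c (1 + m)` is split off, what remains compares
-- `c m * b (1 + m)` with `c (1 + m) * b m`. This holds term by term, since the ratios of `b`
-- decrease.
logConcave-partialSums : ∀ b c → c 0 ≡ 0 → (∀ m → c (suc m) ≡ c m + b m) →
                         (∀ m → 0 < b m) → LogConcave b → LogConcave c
logConcave-partialSums b c c0 c+ pos lc m = begin
  c m * c (2 + m)                      ≡⟨ cong (c m *_) (c+ (1 + m)) ⟩
  c m * (c (1 + m) + b (1 + m))        ≡⟨ *-distribˡ-+ (c m) (c (1 + m)) (b (1 + m)) ⟩
  c m * c (1 + m) + c m * b (1 + m)    ≤⟨ +-mono-≤ (≤-reflexive (*-comm (c m) (c (1 + m)))) (cross m 0) ⟩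
  c (1 + m) * c m + c (1 + m) * b m    ≡⟨ *-distribˡ-+ (c (1 + m)) (c m) (b m) ⟨
  c (1 + m) * (c m + b m)              ≡⟨ cong (c (1 + m) *_) (c+ m) ⟨
  c (1 + m) * c (1 + m)                ∎
  where
  open ≤-Reasoning
  -- The distance `d` is free because the induction lowers `m` while the index `d + m` of `b` stays
  -- fixed.
  cross : ∀ m d → c m * b (suc (d + m)) ≤ c (suc m) * b (d + m)
  cross zero    d rewrite c0 = z≤n
  cross (suc m) d = begin
    c (1 + m) * b (1 + l)                      ≡⟨ cong (_* b (1 + l)) (c+ m) ⟩
    (c m + b m) * b (1 + l)                    ≡⟨ *-distribʳ-+ (b (1 + l)) (c m) (b m) ⟩
    c m * b (1 + l) + b m * b (1 + l)          ≤⟨ +-mono-≤ sums ratio ⟩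
    c (1 + m) * b l + b (1 + m) * b l          ≡⟨ *-distribʳ-+ (b l) (c (1 + m)) (b (1 + m)) ⟨
    (c (1 + m) + b (1 + m)) * b l              ≡⟨ cong (_* b l) (c+ (1 + m)) ⟨
    c (2 + m) * b l                            ∎
    where
    l = d + suc m
    sums : c m * b (1 + l) ≤ c (1 + m) * b l
    sums rewrite +-suc d m = cross m (suc d)
    ratio : b m * b (1 + l) ≤ b (1 + m) * b l
    ratio rewrite +-suc d m = logConcave-ratio b lc (pos ∘ suc) m (suc d)

-- Of the four products in the expansion, log-concavity bounds `w * y` and `x * z`, the ratio lemma
-- at distance 2 bounds `w * z` by `x * y`, and `x * y` is kept.
logConcave-consecutiveSums : ∀ a → (∀ m → 0 < a (suc m)) → LogConcave a →
                             LogConcave (λ m → a m + a (suc m))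
logConcave-consecutiveSums a pos lc m = begin
  (w + x) * (y + z)                      ≡⟨ expand w x y z ⟩
  w * y + x * z + w * z + x * y          ≤⟨ +-monoˡ-≤ (x * y) (+-mono-≤ (+-mono-≤ (lc m) (lc (1 + m)))
                                              (logConcave-ratio a lc pos m 2)) ⟩
  x * x + y * y + x * y + x * y          ≡⟨ square x y ⟩
  (x + y) * (x + y)                      ∎
  where
  open ≤-Reasoning
  w = a m
  x = a (1 + m)
  y = a (2 + m)
  z = a (3 + m)
  expand : ∀ w x y z → (w + x) * (y + z) ≡ w * y + x * z + w * z + x * y
  expand = solve-∀
  square : ∀ x y → x * x + y * y + x * y + x * y ≡ (x + y) * (x + y)
  square = solve-∀

logConcave-* : ∀ a b → LogConcave a → LogConcave b → LogConcave (λ m → a m * b m)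
logConcave-* a b lca lcb m = subst₂ _≤_
  (interchange (a m) (a (2 + m)) (b m) (b (2 + m)))
  (interchange (a (1 + m)) (a (1 + m)) (b (1 + m)) (b (1 + m)))
  (*-mono-≤ (lca m) (lcb m))
  where
  interchange : ∀ p q r s → (p * q) * (r * s) ≡ (p * r) * (q * s)
  interchange = solve-∀

-- Binomial coefficients.

-- The classical absorption identity. After Pascal's rule one copy of `p` is set aside, so that the
-- induction hypothesis applies to both summands.
C-absorb : ∀ n k → suc k * (suc n C suc k) ≡ suc n * (n C k)
C-absorb n       zero    = trans (*-identityˡ (suc n C 1)) (trans (nC1≡n (suc n)) (sym (*-identityʳ (suc n))))
C-absorb zero    (suc k) = trans (cong (suc (suc k) *_) (k>n⇒nCk≡0 {1} {2 + k} (s<s z<s)))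
  (trans (*-zeroʳ (suc (suc k))) (sym (trans (*-identityˡ (0 C suc k)) (k>n⇒nCk≡0 {0} {suc k} z<s))))
C-absorb (suc n) (suc k) = begin
  (2 + k) * (suc (suc n) C (2 + k))               ≡⟨ cong ((2 + k) *_) (nCk+nC[k+1]≡[n+1]C[k+1] (suc n) (suc k)) ⟨
  (2 + k) * (p + (suc n C (2 + k)))               ≡⟨ *-distribˡ-+ (2 + k) p (suc n C (2 + k)) ⟩
  (2 + k) * p + (2 + k) * (suc n C (2 + k))       ≡⟨ cong₂ (λ x y → p + x + y) (C-absorb n k) (C-absorb n (suc k)) ⟩
  p + suc n * (n C k) + suc n * (n C suc k)       ≡⟨ collect n p (n C k) (n C suc k) ⟩
  p + suc n * ((n C k) + (n C suc k))             ≡⟨ cong (λ x → p + suc n * x) (nCk+nC[k+1]≡[n+1]C[k+1] n k) ⟩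
  (2 + n) * p                                     ∎
  where
  open ≡-Reasoning
  p = suc n C suc k
  collect : ∀ n p x y → p + suc n * x + suc n * y ≡ p + suc n * (x + y)
  collect = solve-∀

C-comm : ∀ m n → (m + n) C n ≡ (n + m) C m
C-comm m n = trans (nCk≡nC[n∸k] (m≤n+m n m)) (cong₂ _C_ (+-comm m n) (m+n∸n≡m m n))

-- Together with `C-absorbʳ` this expresses the two binomials in the recurrence of `forests` through
-- a single one, lowering either the vertices without a right child or those with one.
C-absorbˡ : ∀ m j → suc m * ((suc m + j) C j) ≡ (suc m + j) * ((m + j) C j)
C-absorbˡ m j = begin
  suc m * ((suc m + j) C j)          ≡⟨ cong (suc m *_) (C-comm (suc m) j) ⟩
  suc m * ((j + suc m) C suc m)      ≡⟨ cong (λ n → suc m * (n C suc m)) (+-suc j m) ⟩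
  suc m * (suc (j + m) C suc m)      ≡⟨ C-absorb (j + m) m ⟩
  suc (j + m) * ((j + m) C m)        ≡⟨ cong₂ _*_ (cong suc (+-comm j m)) (C-comm j m) ⟩
  suc (m + j) * ((m + j) C j)        ∎
  where
  open ≡-Reasoning

C-absorbʳ : ∀ m j → suc j * ((m + suc j) C suc j) ≡ (m + suc j) * ((m + j) C j)
C-absorbʳ m j rewrite +-suc m j = C-absorb (m + j) j

C-column-suc : ∀ r m → (suc m + r) C suc r ≡ ((m + r) C suc r) + ((m + r) C r)
C-column-suc r m = trans (sym (nCk+nC[k+1]≡[n+1]C[k+1] (m + r) r)) (+-comm ((m + r) C r) ((m + r) C suc r))

C-pos : ∀ {n k} → k ≤ n → 0 < n C k
C-pos {n}     {zero}  _         = z<s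
C-pos {suc n} {suc k} (s≤s k≤n) rewrite sym (nCk+nC[k+1]≡[n+1]C[k+1] n k) =
  ≤-trans (C-pos k≤n) (m≤m+n (n C k) (n C suc k))

-- Column `suc r` of Pascal's triangle consists of the partial sums of column `r`.
C-column-logConcave : ∀ r → LogConcave (λ m → (m + r) C r)
C-column-logConcave zero    m = ≤-refl
C-column-logConcave (suc r) m rewrite +-suc m r =
  -- The partial sums start with the entry `r C suc r`, which is 0; the wanted column is this
  -- sequence shifted by one, whence the index `suc m`.
  logConcave-partialSums (λ m → (m + r) C r) (λ m → (m + r) C suc r) (k>n⇒nCk≡0 (n<1+n r))
    (C-column-suc r) (λ m → C-pos (m≤n+m r m)) (C-column-logConcave r) (suc m)

-- Coefficients of a Laurent polynomial.

-- laurent j m r is the coefficient of y ^ r in (1 + y) ^ m * (1 + 2 / y) ^ j.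
laurent : ℕ → ℕ → ℕ → ℕ
laurent zero    m r = m C r
laurent (suc j) m r = laurent j m r + 2 * laurent j m (suc r)

-- Multiplication by one more factor `1 + y`, which commutes with the factors `1 + 2 / y`. The index
-- is a successor because only nonnegative powers of `y` are recorded.
laurent-suc : ∀ j m r → laurent j (suc m) (suc r) ≡ laurent j m r + laurent j m (suc r)
laurent-suc zero    m r = sym (nCk+nC[k+1]≡[n+1]C[k+1] m r)
laurent-suc (suc j) m r rewrite laurent-suc j m r | laurent-suc j m (suc r) =
  rearrange (laurent j m r) (laurent j m (suc r)) (laurent j m (2 + r))
  where
  rearrange : ∀ x y z → x + y + 2 * (y + z) ≡ x + 2 * y + (y + 2 * z)
  rearrange = solve-∀

-- At `m = 0` only `(1 + 2 / y) ^ j` is left, which has no positive powers of `y`.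
laurent-zero : ∀ j r → laurent j 0 (suc r) ≡ 0
laurent-zero zero    r = k>n⇒nCk≡0 {0} {suc r} z<s
laurent-zero (suc j) r rewrite laurent-zero j r | laurent-zero j (suc r) = refl

-- Apply y d/dy to the product defining laurent; the term with laurent (j ∸ 1)
-- is moved to the left and vanishes for j = 0.
laurent-euler : ∀ j m r → suc r * laurent j (suc m) (suc r) + 2 * (j * laurent (j ∸ 1) (suc m) (2 + r))
                        ≡ suc m * laurent j m r
laurent-euler zero    m r = trans (+-identityʳ _) (C-absorb m r)
laurent-euler (suc j) m r = begin
  suc r * (h 1 + 2 * h 2) + 2 * (suc j * h 2)                                  ≡⟨ split r (h 1) (h 2) (j * h 2) ⟩
  suc r * h 1 + 2 * (j * h 2) + 2 * (suc (suc r) * h 2)                        ≡⟨ cong (λ x → suc r * h 1 + 2 * x + 2 * (suc (suc r) * h 2)) (pascal j r) ⟩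
  suc r * h 1 + 2 * (g 2 + 2 * g 3) + 2 * (suc (suc r) * h 2)                  ≡⟨ join (suc r * h 1) (g 2) (g 3) (suc (suc r) * h 2) ⟩
  -- The induction hypothesis is used at `r` and at `suc r`, the two coefficients that the factor
  -- `1 + 2 / y` combines.
  (suc r * h 1 + 2 * g 2) + 2 * (suc (suc r) * h 2 + 2 * g 3)                  ≡⟨ cong₂ (λ x y → x + 2 * y) (laurent-euler j m r) (laurent-euler j m (suc r)) ⟩
  suc m * laurent j m r + 2 * (suc m * laurent j m (suc r))                    ≡⟨ factor m (laurent j m r) (laurent j m (suc r)) ⟩
  suc m * (laurent j m r + 2 * laurent j m (suc r))                            ∎
  where
  open ≡-Reasoning
  h g : ℕ → ℕ
  h i = laurent j (suc m) (i + r)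
  g i = j * laurent (j ∸ 1) (suc m) (i + r)
  -- The factor `j` makes both sides vanish at `j = 0`, where `j ∸ 1` is no true predecessor.
  pascal : ∀ j r → j * laurent j (suc m) (2 + r)
         ≡ j * laurent (j ∸ 1) (suc m) (2 + r) + 2 * (j * laurent (j ∸ 1) (suc m) (3 + r))
  pascal zero    r = refl
  pascal (suc j) r = distrib (suc j) (laurent j (suc m) (2 + r)) (laurent j (suc m) (3 + r))
    where
    distrib : ∀ j x y → j * (x + 2 * y) ≡ j * x + 2 * (j * y)
    distrib = solve-∀
  split : ∀ r x y z → suc r * (x + 2 * y) + 2 * (y + z) ≡ suc r * x + 2 * z + 2 * (suc (suc r) * y)
  split = solve-∀
  join : ∀ x y z w → x + 2 * (y + 2 * z) + 2 * w ≡ (x + 2 * y) + 2 * (w + 2 * z)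
  join = solve-∀
  factor : ∀ m x y → suc m * x + 2 * (suc m * y) ≡ suc m * (x + 2 * y)
  factor = solve-∀

-- The coefficient at index 2 enters both sides equally, so the increment in `m` involves
-- coefficients at index 1 only, and the induction on `j` can stay at that index.
laurent-1-suc : ∀ j m → laurent (suc j) (suc m) 1
              ≡ laurent (suc j) m 1 + (laurent j m 1 + laurent j (suc m) 1)
laurent-1-suc j m rewrite laurent-suc j m 1 =
  rearrange (laurent j (suc m) 1) (laurent j m 1) (laurent j m 2)
  where
  rearrange : ∀ x y z → x + 2 * (y + z) ≡ y + 2 * z + (y + x)
  rearrange = solve-∀

laurent-1-pos : ∀ j m → 0 < laurent j (suc m) 1
laurent-1-pos zero    m rewrite nC1≡n (suc m) = z<s
laurent-1-pos (suc j) m = ≤-trans (laurent-1-pos j m) (m≤m+n _ _)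

laurent-1-logConcave : ∀ j → LogConcave (λ m → laurent j m 1)
laurent-1-logConcave zero    m rewrite nC1≡n m | nC1≡n (suc m) | nC1≡n (2 + m) =
  ≤-trans (m≤m+n _ 1) (≤-reflexive (square m))
  where
  square : ∀ m → m * (2 + m) + 1 ≡ suc m * suc m
  square = solve-∀
laurent-1-logConcave (suc j) =
  logConcave-partialSums (λ m → laurent j m 1 + laurent j (suc m) 1) (λ m → laurent (suc j) m 1) (laurent-zero (suc j) 0) (laurent-1-suc j)
    -- Positivity is needed at `m = 0` too, where the first summand is 0; the second summand
    -- provides it.
    (λ m → ≤-trans (laurent-1-pos j m) (m≤n+m _ _))
    (logConcave-consecutiveSums (λ m → laurent j m 1) (laurent-1-pos j) (laurent-1-logConcave j))

-- Forest numbers and their closed form.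

-- Łukasiewicz words: forests r m j counts the sequences of r 0-1-trees with m
-- vertices that lack a right child and j vertices that have one.
forests : ℕ → ℕ → ℕ → ℕ
forests zero    zero    zero    = 1
forests zero    zero    (suc j) = 0
forests zero    (suc m) j       = 0
forests (suc r) zero    zero    = 0
forests (suc r) (suc m) zero    = (forests r m 0 + forests (suc r) m 0) + 0
forests (suc r) zero    (suc j) = forests (suc r) 0 j + 2 * forests (2 + r) 0 j
forests (suc r) (suc m) (suc j) =
  (forests r m (suc j) + forests (suc r) m (suc j)) + (forests (suc r) (suc m) j + 2 * forests (2 + r) (suc m) j)

-- A nonempty forest has a leaf, hence a vertex without a right child.
forests-m≡0 : ∀ r j → forests (suc r) 0 j ≡ 0
forests-m≡0 r zero    = refl
forests-m≡0 r (suc j) rewrite forests-m≡0 r j | forests-m≡0 (suc r) j = refl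

-- Without right edges every tree is a left path, so these forests are the compositions of `suc m`
-- into `suc r` parts.
forests-j≡0 : ∀ r m → forests (suc r) (suc m) 0 ≡ m C r
forests-j≡0 zero    zero    = refl
forests-j≡0 (suc r) zero    = sym (k>n⇒nCk≡0 {0} {suc r} z<s)
forests-j≡0 zero    (suc m) = trans (+-identityʳ _) (forests-j≡0 zero m)
forests-j≡0 (suc r) (suc m) = trans (+-identityʳ _)
  (trans (cong₂ _+_ (forests-j≡0 r m) (forests-j≡0 (suc r) m)) (nCk+nC[k+1]≡[n+1]C[k+1] m r))

-- Induction on the size: multiplied by (m + j) (m + j - 1), the recurrence of
-- forests reduces to Pascal's rule and laurent-euler, which makes the factor
-- m + j - 1 cancel.
forests-formula : ∀ r m j → (m + j) * forests r m j ≡ r * (((m + j) C j) * laurent j m r)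
forests-formula zero    zero    zero    = refl
forests-formula zero    zero    (suc j) = *-zeroʳ (suc j)
forests-formula zero    (suc m) j       = *-zeroʳ (suc m + j)
forests-formula (suc r) zero    j       rewrite forests-m≡0 r j | laurent-zero j r | *-zeroʳ (j C j) =
  trans (*-zeroʳ j) (sym (*-zeroʳ r))
forests-formula (suc r) (suc m) zero    rewrite +-identityʳ m | forests-j≡0 r m =
  trans (sym (C-absorb m r)) (cong (suc r *_) (sym (*-identityˡ (suc m C suc r))))
forests-formula (suc r) (suc m) (suc j) =
  *-cancelˡ-≡ _ _ N′ {{>-nonZero (≤-trans z<s (m≤n+m (suc j) m))}} (begin
    N′ * (N * ((F₁ + F₂) + (F₃ + 2 * F₄)))
      ≡⟨ distribute N′ N F₁ F₂ F₃ F₄ ⟩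
    N * ((N′ * F₁ + N′ * F₂) + (N′ * F₃ + 2 * (N′ * F₄)))
      ≡⟨ cong (N *_) (cong₂ _+_
           (cong₂ _+_ (forests-formula r m (suc j)) (forests-formula (suc r) m (suc j)))
           (cong₂ (λ x y → x + 2 * y) (shifted (suc r)) (shifted (2 + r)))) ⟩
    N * ((r * (B₁ * h₁) + suc r * (B₁ * h₂)) + (suc r * (B₂ * g₁) + 2 * ((2 + r) * (B₂ * g₂))))
      ≡⟨ regroup N r B₁ B₂ h₁ h₂ g₁ g₂ ⟩
    (N * B₁) * (r * h₁ + suc r * h₂) + (N * B₂) * (suc r * g₁ + 2 * ((2 + r) * g₂))
      ≡⟨ cong₂ (λ x y → x * (r * h₁ + suc r * h₂) + y * (suc r * g₁ + 2 * ((2 + r) * g₂)))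
           (sym (C-absorbˡ m (suc j))) (sym (C-absorbʳ (suc m) j)) ⟩
    (suc m * B) * (r * h₁ + suc r * h₂) + (suc j * B) * (suc r * g₁ + 2 * ((2 + r) * g₂))
      -- To avoid subtraction, `B` times the left side of `laurent-euler` is added to both sides. It
      -- turns `r * h₁` into `suc r * h₁`, after which `laurent-suc` applies.
      ≡⟨ +-cancelʳ-≡ (B * (suc r * (g₁ + 2 * g₂) + 2 * (suc j * g₂))) _ _ (euler m j r B h₁ h₂ g₁ g₂
           (laurent-suc (suc j) m r) (laurent-euler (suc j) m r)) ⟩
    N′ * (suc r * (B * laurent (suc j) (suc m) (suc r)))
      ∎)
  where
  open ≡-Reasoning
  N N′ F₁ F₂ F₃ F₄ B B₁ B₂ h₁ h₂ g₁ g₂ : ℕ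
  N′ = m + suc j
  N  = suc N′
  F₁ = forests r m (suc j)
  F₂ = forests (suc r) m (suc j)
  F₃ = forests (suc r) (suc m) j
  F₄ = forests (2 + r) (suc m) j
  B  = N C suc j
  B₁ = N′ C suc j
  B₂ = (suc m + j) C j
  h₁ = laurent (suc j) m r
  h₂ = laurent (suc j) m (suc r)
  g₁ = laurent j (suc m) (suc r)
  g₂ = laurent j (suc m) (2 + r)
  shifted : ∀ s → N′ * forests s (suc m) j ≡ s * (B₂ * laurent j (suc m) s)
  shifted s = trans (cong (_* forests s (suc m) j) (+-suc m j)) (forests-formula s (suc m) j)
  distribute : ∀ n′ n a b c d → n′ * (n * ((a + b) + (c + 2 * d)))
             ≡ n * ((n′ * a + n′ * b) + (n′ * c + 2 * (n′ * d)))
  distribute = solve-∀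
  regroup : ∀ n r b₁ b₂ x₁ x₂ y₁ y₂ →
            n * ((r * (b₁ * x₁) + suc r * (b₁ * x₂)) + (suc r * (b₂ * y₁) + 2 * ((2 + r) * (b₂ * y₂))))
          ≡ (n * b₁) * (r * x₁ + suc r * x₂) + (n * b₂) * (suc r * y₁ + 2 * ((2 + r) * y₂))
  regroup = solve-∀
  euler : ∀ m j r b x₁ x₂ y₁ y₂ → y₁ + 2 * y₂ ≡ x₁ + x₂ →
          suc r * (y₁ + 2 * y₂) + 2 * (suc j * y₂) ≡ suc m * x₁ →
          (suc m * b) * (r * x₁ + suc r * x₂) + (suc j * b) * (suc r * y₁ + 2 * ((2 + r) * y₂))
            + b * (suc r * (y₁ + 2 * y₂) + 2 * (suc j * y₂))
        ≡ (m + suc j) * (suc r * (b * (y₁ + 2 * y₂))) + b * (suc r * (y₁ + 2 * y₂) + 2 * (suc j * y₂))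
  euler m j r b x₁ x₂ y₁ y₂ pascal eq = begin
    lhs + b * (suc r * (y₁ + 2 * y₂) + 2 * (suc j * y₂))  ≡⟨ cong (λ z → lhs + b * z) eq ⟩
    lhs + b * (suc m * x₁)                                ≡⟨ gather m j r b x₁ x₂ y₁ y₂ ⟩
    (suc m * b) * (suc r * (x₁ + x₂)) + rest              ≡⟨ cong (λ z → (suc m * b) * (suc r * z) + rest) pascal ⟨
    (suc m * b) * (suc r * (y₁ + 2 * y₂)) + rest          ≡⟨ finish m j r b y₁ y₂ ⟩
    (m + suc j) * (suc r * (b * (y₁ + 2 * y₂))) + b * (suc r * (y₁ + 2 * y₂) + 2 * (suc j * y₂)) ∎
    where
    rest = (suc j * b) * (suc r * y₁ + 2 * ((2 + r) * y₂))
    lhs  = (suc m * b) * (r * x₁ + suc r * x₂) + rest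
    gather : ∀ m j r b x₁ x₂ y₁ y₂ →
             (suc m * b) * (r * x₁ + suc r * x₂) + (suc j * b) * (suc r * y₁ + 2 * ((2 + r) * y₂))
               + b * (suc m * x₁)
           ≡ (suc m * b) * (suc r * (x₁ + x₂)) + (suc j * b) * (suc r * y₁ + 2 * ((2 + r) * y₂))
    gather = solve-∀
    finish : ∀ m j r b y₁ y₂ →
             (suc m * b) * (suc r * (y₁ + 2 * y₂)) + (suc j * b) * (suc r * y₁ + 2 * ((2 + r) * y₂))
           ≡ (m + suc j) * (suc r * (b * (y₁ + 2 * y₂))) + b * (suc r * (y₁ + 2 * y₂) + 2 * (suc j * y₂))
    finish = solve-∀

-- Forests of 0-1-trees and their enumeration.

rightless : 01Tree → ℕ
rightless leaf          = 1
rightless (onlyLeft l)  = suc (rightless l)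
rightless (onlyRight r) = rightless r
rightless (both _ l r)  = rightless l + rightless r

-- Each vertex either lacks a right child or is the upper end of exactly one right edge.
vertices≡rightless+rightEdges : ∀ t → vertices t ≡ rightless t + rightEdges t
vertices≡rightless+rightEdges leaf          = refl
vertices≡rightless+rightEdges (onlyLeft l)  = cong suc (vertices≡rightless+rightEdges l)
vertices≡rightless+rightEdges (onlyRight r) =
  trans (cong suc (vertices≡rightless+rightEdges r)) (sym (+-suc (rightless r) (rightEdges r)))
vertices≡rightless+rightEdges (both _ l r)
  rewrite vertices≡rightless+rightEdges l | vertices≡rightless+rightEdges r =
  interchange (rightless l) (rightEdges l) (rightless r) (rightEdges r)
  where
  interchange : ∀ a b c d → suc ((a + b) + (c + d)) ≡ (a + c) + suc (b + d)
  interchange = solve-∀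

rightless* rightEdges* : ∀ {r} → Vec 01Tree r → ℕ
rightless* []       = 0
rightless* (t ∷ ts) = rightless t + rightless* ts
rightEdges* []       = 0
rightEdges* (t ∷ ts) = rightEdges t + rightEdges* ts

WithStatistics : {A : Set} → (A → ℕ) → (A → ℕ) → ℕ → ℕ → Set
WithStatistics f g m n = ∃ λ x → f x ≡ m × g x ≡ n

WithStatistics-≡ : ∀ {A : Set} {f g : A → ℕ} {m n} {x y : WithStatistics f g m n} →
                   proj₁ x ≡ proj₁ y → x ≡ y
WithStatistics-≡ {x = x , p , q} {y = _ , p′ , q′} refl =
  cong (x ,_) (cong₂ _,_ (≡-irrelevant p p′) (≡-irrelevant q q′))

Forest : ℕ → ℕ → ℕ → Set
Forest r = WithStatistics (rightless* {r}) rightEdges*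

-- What remains when the root of the first tree is removed and its subtrees join the `r` other
-- trees, according to whether that root has a right child. `Fin 2` keeps the label of a root with
-- two children.
RightlessRoot RightfulRoot : ℕ → ℕ → ℕ → Set
RightlessRoot r zero    j = ⊥
RightlessRoot r (suc m) j = Forest r m j ⊎ Forest (suc r) m j
RightfulRoot r m zero    = ⊥
RightfulRoot r m (suc j) = Forest (suc r) m j ⊎ (Fin 2 × Forest (2 + r) m j)

Forest-removeRoot : ∀ r m j → Forest (suc r) m j ↔ (RightlessRoot r m j ⊎ RightfulRoot r m j)
Forest-removeRoot r m j = mk↔ₛ′ (to m j) (from m j) (to∘from m j) (from∘to m j)
  where
  to : ∀ m j → Forest (suc r) m j → RightlessRoot r m j ⊎ RightfulRoot r m j
  to (suc m) j (leaf ∷ ts , p , q)         = inj₁ (inj₁ (ts , suc-injective p , q))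
  to (suc m) j (onlyLeft t ∷ ts , p , q)   = inj₁ (inj₂ (t ∷ ts , suc-injective p , q))
  to m (suc j) (onlyRight t ∷ ts , p , q)  = inj₂ (inj₁ (t ∷ ts , p , suc-injective q))
  to m (suc j) (both b t u ∷ ts , p , q)   = inj₂ (inj₂ (b , t ∷ u ∷ ts ,
    trans (sym (+-assoc (rightless t) (rightless u) (rightless* ts))) p ,
    trans (sym (+-assoc (rightEdges t) (rightEdges u) (rightEdges* ts))) (suc-injective q)))
  from : ∀ m j → RightlessRoot r m j ⊎ RightfulRoot r m j → Forest (suc r) m j
  from (suc m) j (inj₁ (inj₁ (ts , p , q)))              = leaf ∷ ts , cong suc p , q
  from (suc m) j (inj₁ (inj₂ (t ∷ ts , p , q)))          = onlyLeft t ∷ ts , cong suc p , q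
  from m (suc j) (inj₂ (inj₁ (t ∷ ts , p , q)))          = onlyRight t ∷ ts , p , cong suc q
  from m (suc j) (inj₂ (inj₂ (b , t ∷ u ∷ ts , p , q)))  = both b t u ∷ ts ,
    trans (+-assoc (rightless t) (rightless u) (rightless* ts)) p ,
    cong suc (trans (+-assoc (rightEdges t) (rightEdges u) (rightEdges* ts)) q)
  to∘from : ∀ m j x → to m j (from m j x) ≡ x
  to∘from (suc m) j (inj₁ (inj₁ _))                      = cong (inj₁ ∘ inj₁) (WithStatistics-≡ refl)
  to∘from (suc m) j (inj₁ (inj₂ (_ ∷ _ , _)))            = cong (inj₁ ∘ inj₂) (WithStatistics-≡ refl)
  to∘from zero    (suc j) (inj₂ (inj₁ (_ ∷ _ , _)))         = cong (inj₂ ∘ inj₁) (WithStatistics-≡ refl)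
  to∘from zero    (suc j) (inj₂ (inj₂ (b , _ ∷ _ ∷ _ , _))) =
    cong (λ f → inj₂ (inj₂ (b , f))) (WithStatistics-≡ refl)
  to∘from (suc m) (suc j) (inj₂ (inj₁ (_ ∷ _ , _)))         = cong (inj₂ ∘ inj₁) (WithStatistics-≡ refl)
  to∘from (suc m) (suc j) (inj₂ (inj₂ (b , _ ∷ _ ∷ _ , _))) =
    cong (λ f → inj₂ (inj₂ (b , f))) (WithStatistics-≡ refl)
  from∘to : ∀ m j f → from m j (to m j f) ≡ f
  from∘to (suc m) j (leaf ∷ _ , _)          = WithStatistics-≡ refl
  from∘to (suc m) j (onlyLeft _ ∷ _ , _)    = WithStatistics-≡ refl
  from∘to zero    (suc j) (onlyRight _ ∷ _ , _) = WithStatistics-≡ refl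
  from∘to zero    (suc j) (both _ _ _ ∷ _ , _)  = WithStatistics-≡ refl
  from∘to (suc m) (suc j) (onlyRight _ ∷ _ , _) = WithStatistics-≡ refl
  from∘to (suc m) (suc j) (both _ _ _ ∷ _ , _)  = WithStatistics-≡ refl

Fin-+ : ∀ {m n} {A B : Set} → Fin m ↔ A → Fin n ↔ B → Fin (m + n) ↔ (A ⊎ B)
Fin-+ f g = ↔-trans +↔⊎ (f ⊎-↔ g)

Fin-* : ∀ {m n} {A B : Set} → Fin m ↔ A → Fin n ↔ B → Fin (m * n) ↔ (A × B)
Fin-* f g = ↔-trans *↔× (f ×-↔ g)

-- The clauses of `forests` follow `Forest-removeRoot` summand by summand; a summand 0 stands for
-- the empty type.
forests-cardinality : ∀ r m j → Fin (forests r m j) ↔ Forest r m j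
forests-cardinality zero    zero    zero    = mk↔ₛ′ (λ _ → [] , refl , refl) (λ _ → zero)
  (λ { ([] , refl , refl) → refl }) (λ { zero → refl })
forests-cardinality zero    zero    (suc j) = mk↔ₛ′ (λ ()) (λ { ([] , _ , ()) }) (λ { ([] , _ , ()) }) (λ ())
forests-cardinality zero    (suc m) j       = mk↔ₛ′ (λ ()) (λ { ([] , () , _) }) (λ { ([] , () , _) }) (λ ())
forests-cardinality (suc r) zero    zero    =
  ↔-trans (Fin-+ {0} {0} 0↔⊥ 0↔⊥) (↔-sym (Forest-removeRoot r 0 0))
forests-cardinality (suc r) (suc m) zero    = ↔-trans
  (Fin-+ (Fin-+ (forests-cardinality r m 0) (forests-cardinality (suc r) m 0)) 0↔⊥)
  (↔-sym (Forest-removeRoot r (suc m) 0))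
forests-cardinality (suc r) zero    (suc j) = ↔-trans
  (Fin-+ {0} 0↔⊥ (Fin-+ (forests-cardinality (suc r) 0 j) (Fin-* {2} ↔-refl (forests-cardinality (2 + r) 0 j))))
  (↔-sym (Forest-removeRoot r 0 (suc j)))
forests-cardinality (suc r) (suc m) (suc j) = ↔-trans
  (Fin-+ (Fin-+ (forests-cardinality r m (suc j)) (forests-cardinality (suc r) m (suc j)))
         (Fin-+ (forests-cardinality (suc r) (suc m) j) (Fin-* {2} ↔-refl (forests-cardinality (2 + r) (suc m) j))))
  (↔-sym (Forest-removeRoot r (suc m) (suc j)))

-- Boolean-Narayana numbers and the conclusion.

HasShape↔Forest : ∀ m j → ∃ (HasShape (m + j) j) ↔ Forest 1 m j
HasShape↔Forest m j = mk↔ₛ′ to from (λ { (_ ∷ [] , _) → WithStatistics-≡ refl }) (λ _ → WithStatistics-≡ refl)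
  where
  to : ∃ (HasShape (m + j) j) → Forest 1 m j
  to (t , v , q) = t ∷ [] ,
    trans (+-identityʳ _) (+-cancelʳ-≡ (rightEdges t) _ _
      (trans (sym (vertices≡rightless+rightEdges t)) (trans v (cong (m +_) (sym q))))) ,
    trans (+-identityʳ _) q
  from : Forest 1 m j → ∃ (HasShape (m + j) j)
  from (t ∷ [] , p , q) = t ,
    trans (vertices≡rightless+rightEdges t)
      (cong₂ _+_ (trans (sym (+-identityʳ _)) p) (trans (sym (+-identityʳ _)) q)) ,
    trans (sym (+-identityʳ _)) q

BoNa≡forests : ∀ m j → BoNa (m + j) (suc j) ≡ forests 1 m j
BoNa≡forests m j = ↔⇒≡ (↔-trans (BoNa-cardinality (m + j) (suc j))
  (↔-trans (HasShape↔Forest m j) (↔-sym (forests-cardinality 1 m j))))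

-- The case `r = 1` of `forests-formula`. Absorption trades the factor `N`, which varies with `m`,
-- for the constant `suc j`, and scaling by a constant does not affect log-concavity.
BoNa-formula : ∀ m j → suc j * BoNa (m + suc j) (2 + j) ≡ ((m + j) C j) * laurent (suc j) m 1
BoNa-formula m j = *-cancelˡ-≡ _ _ N {{>-nonZero (≤-trans z<s (m≤n+m (suc j) m))}} (begin
  N * (suc j * BoNa N (2 + j))          ≡⟨ cong (λ x → N * (suc j * x)) (BoNa≡forests m (suc j)) ⟩
  N * (suc j * forests 1 m (suc j))     ≡⟨ exchange N (suc j) (forests 1 m (suc j)) ⟩
  suc j * (N * forests 1 m (suc j))     ≡⟨ cong (suc j *_) (trans (forests-formula 1 m (suc j)) (*-identityˡ _)) ⟩
  suc j * ((N C suc j) * h)             ≡⟨ *-assoc (suc j) (N C suc j) h ⟨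
  (suc j * (N C suc j)) * h             ≡⟨ cong (_* h) (C-absorbʳ m j) ⟩
  (N * ((m + j) C j)) * h               ≡⟨ *-assoc N ((m + j) C j) h ⟩
  N * (((m + j) C j) * h)               ∎)
  where
  open ≡-Reasoning
  N = m + suc j
  h = laurent (suc j) m 1
  exchange : ∀ x y z → x * (y * z) ≡ y * (x * z)
  exchange = solve-∀

logConcave-scaled : ∀ c a b → (∀ m → suc c * a m ≡ b m) → LogConcave b → LogConcave a
logConcave-scaled c a b eq lc m = *-cancelˡ-≤ (suc c * suc c)
  (subst₂ _≤_ (square m (2 + m)) (square (1 + m) (1 + m)) (lc m))
  where
  interchange : ∀ c x y → (c * x) * (c * y) ≡ (c * c) * (x * y)
  interchange = solve-∀
  square : ∀ i j → b i * b j ≡ (suc c * suc c) * (a i * a j)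
  square i j = trans (cong₂ _*_ (sym (eq i)) (sym (eq j))) (interchange (suc c) (a i) (a j))

BoNa-logConcave : ∀ j → LogConcave (λ m → BoNa (m + suc j) (2 + j))
BoNa-logConcave j = logConcave-scaled j (λ m → BoNa (m + suc j) (2 + j))
  (λ m → ((m + j) C j) * laurent (suc j) m 1) (λ m → BoNa-formula m j)
  (logConcave-* (λ m → (m + j) C j) (λ m → laurent (suc j) m 1)
    (C-column-logConcave j) (laurent-1-logConcave (suc j)))

LogConcave⇒LogConcaveFrom : ∀ d a m → d ≤ m → LogConcave (λ i → a (i + d)) → LogConcaveFrom m a
LogConcave⇒LogConcaveFrom d a m d≤m lc (suc i) (s≤s m≤i) = begin
  a i * a (suc i + 1)      ≡⟨ cong (λ n → a i * a n) (+-comm (suc i) 1) ⟩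
  a i * a (2 + i)          ≤⟨ subst (λ n → a n * a (2 + n) ≤ a (1 + n) * a (1 + n))
                                (m∸n+n≡m (≤-trans d≤m m≤i)) (lc (i ∸ d)) ⟩
  a (1 + i) * a (1 + i)    ≡⟨ cong (a (1 + i) *_) (*-identityʳ (a (1 + i))) ⟨
  a (1 + i) ^ 2            ∎
  where
  open ≤-Reasoning

theorem8p1 : (k : ℕ) → 1 < k → LogConcaveFrom (k + 1) (λ n → BoNa n k)
theorem8p1 (suc (suc j)) _ =
  -- Here `k` is `2 + j`, and `m + suc j` runs from `k - 1` on, a range that contains all `n` from
  -- `k + 1` on.
  LogConcave⇒LogConcaveFrom (suc j) (λ n → BoNa n (2 + j)) (2 + j + 1)
    (≤-trans (n≤1+n (suc j)) (m≤m+n (2 + j) 1)) (BoNa-logConcave j)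
theorem8p1 (suc zero) (s≤s ())
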